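{- There exists a $(121,11;9)$ Heffter net over the additive group of $\mathbb F_{3^5}$.
   Context: A half-set of an abelian group $G$ of odd order $2v+1\ge7$ is a subset $V\subseteq G\setminus\{0\}$ containing exactly one element of each pair $\{g,-g\}$, $g\ne0$. A $(v,k)$ Heffter system on $V$ is a partition of $V$ into blocks of size $k$ each summing to $0$ in $G$. A $(k^2,k;r)$ Heffter net over $G$ (with $|G|=2k^2+1$) is a partial linear space (any two distinct points lie in at most one block) whose point set is a half-set $V$ of $G$, with a resolution of its blocks into $r$ parallel classes (each a partition of $V$), each of which is a $(k^2,k)$ Heffter system. -}

module Defs where

open import Level using (Level; 0ℓ; _⊔_) renaming (suc to lsuc)
open import Algebra.Bundles using (AbelianGroup; CommutativeRing)
open import Algebra.Apartness.Bundles using (HeytingField; HeytingCommutativeRing)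
open import Data.Fin.Base using (Fin; zero; suc)
import Data.Fin.Properties as Fin
open import Data.List.Base using (List; []; length; foldr)
import Data.List.Membership.Propositional as Propositional
import Data.List.Membership.Setoid as Membership
import Data.List.Relation.Binary.Disjoint.Setoid as DisjointLists
import Data.List.Relation.Binary.Subset.Setoid as Subset
open import Data.List.Relation.Unary.All using (All)
open import Data.List.Relation.Unary.AllPairs using (AllPairs)
open import Data.List.Relation.Unary.Any using (Any)
import Data.List.Relation.Unary.Unique.Setoid as UniqueLists
open import Data.Nat.Base as ℕ using (ℕ; _≤_)
open import Data.Product.Base using (_×_; _,_; ∃)
open import Data.Product.Function.NonDependent.Propositional using (_×-↔_)
open import Data.Sum.Base using (_⊎_; fromInj₂)
open import Data.Vec.Base as Vec using (Vec; []; _∷_; replicate; zipWith)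
import Data.Vec.Properties as Vec
open import Function.Base using (_∘_)
open import Function.Bundles using (Inverse; _↔_; mk↔ₛ′)
import Function.Construct.Composition as Compose
import Function.Construct.Identity as Identity
import Function.Construct.Symmetry as Symmetry
open import Relation.Binary.Definitions using (_Respects_)
open import Relation.Binary.PropositionalEquality hiding (setoid)
import Relation.Binary.PropositionalEquality as ≡
open import Relation.Nullary using (¬_; Dec; contradiction)
open import Relation.Nullary.Decidable using (map′; toWitness; _⊎-dec_)
open import Relation.Unary using (Pred; _∈_; _∉_; Decidable)

module _ {c ℓ} (G : AbelianGroup c ℓ) where

  open AbelianGroup G renaming (_∙_ to _+_; ε to 0#; _⁻¹ to -_; Carrier to ∣G∣)
    hiding (sym; trans; refl)

  HasOrder : ℕ → Set (c ⊔ ℓ)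
  HasOrder n = Inverse setoid (≡.setoid (Fin n))

  record IsHalfSet (v : ℕ) (V : Pred ∣G∣ ℓ) : Set (c ⊔ ℓ) where
    field
      order      : HasOrder (2 ℕ.* v ℕ.+ 1)
      order≥7    : 7 ≤ 2 ℕ.* v ℕ.+ 1
      respects   : V Respects _≈_
      0∉V        : 0# ∉ V
      exactlyOne : ∀ g → ¬ (g ≈ 0#) → (g ∈ V × - g ∉ V) ⊎ (g ∉ V × - g ∈ V)

  -- A block is a finite subset of G, given by a list of its elements;
  -- Heffter systems require these lists to be duplicate-free.
  Block : Set c
  Block = List ∣G∣

  open Membership setoid using () renaming (_∈_ to _∈ᴮ_)
  open DisjointLists setoid using (Disjoint)
  open Subset setoid using (_⊆_)
  open UniqueLists setoid using (Unique)

  _≋_ : Block → Block → Set (c ⊔ ℓ)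
  B ≋ C = B ⊆ C × C ⊆ B

  record IsPartition (V : Pred ∣G∣ ℓ) (P : List Block) : Set (c ⊔ ℓ) where
    field
      nonempty : All (λ B → ¬ (B ≡ [])) P
      within   : All (All V) P
      covers   : ∀ x → x ∈ V → Any (x ∈ᴮ_) P
      disjoint : AllPairs Disjoint P

  record IsHeffterSystem (v k : ℕ) (V : Pred ∣G∣ ℓ) (P : List Block) : Set (c ⊔ ℓ) where
    field
      isHalfSet   : IsHalfSet v V
      isPartition : IsPartition V P
      unique      : All Unique P
      size        : All (λ B → length B ≡ k) P
      zeroSum     : All (λ B → foldr _+_ 0# B ≈ 0#) P

  record IsPartialLinearSpace (V : Pred ∣G∣ ℓ) (𝓑 : Pred Block c) : Set (c ⊔ ℓ) where
    field
      within    : ∀ {B} → B ∈ 𝓑 → All V B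
      atMostOne : ∀ {x y B C} → ¬ (x ≈ y) → B ∈ 𝓑 → C ∈ 𝓑 →
                   x ∈ᴮ B → y ∈ᴮ B → x ∈ᴮ C → y ∈ᴮ C → B ≋ C

  record HeffterNet (v k r : ℕ) : Set (c ⊔ lsuc ℓ) where
    field
      v≡k²  : v ≡ k ℕ.* k
      V     : Pred ∣G∣ ℓ
      class : Fin r → List Block

    open Propositional using () renaming (_∈_ to _∈ᶜ_)

    blocks : Pred Block c
    blocks B = ∃ λ i → B ∈ᶜ class i

    field
      isHalfSet            : IsHalfSet v V
      isPartialLinearSpace : IsPartialLinearSpace V blocks
      isHeffterSystem      : ∀ i → IsHeffterSystem v k V (class i)
      -- the classes are disjoint as sets of blocks, so they resolve the block set
      classesDisjoint      : ∀ {i j B C} → B ∈ᶜ class i → C ∈ᶜ class j → B ≋ C → i ≡ j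

-- The field with three elements: the integers modulo 3.

module F₃ where

  infixl 6 _+_
  infixl 7 _*_

  F : Set
  F = Fin 3

  pattern 0# = zero
  pattern 1# = suc zero
  pattern 2# = suc (suc zero)

  -_ : F → F
  - 0# = 0#
  - 1# = 2#
  - 2# = 1#

  _+_ : F → F → F
  0# + b  = b
  1# + 0# = 1#
  1# + 1# = 2#
  1# + 2# = 0#
  2# + 0# = 2#
  2# + 1# = 0#
  2# + 2# = 1#

  _*_ : F → F → F
  0# * b = 0#
  1# * b = b
  2# * b = - b

  private
    all₁ : {P : F → Set} → (∀ a → Dec (P a)) → Dec (∀ a → P a)
    all₁ = Fin.all?
    all₂ : {P : F → F → Set} → (∀ a b → Dec (P a b)) → Dec (∀ a b → P a b)
    all₂ P? = all₁ λ a → all₁ (P? a)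
    all₃ : {P : F → F → F → Set} → (∀ a b c → Dec (P a b c)) → Dec (∀ a b c → P a b c)
    all₃ P? = all₁ λ a → all₂ (P? a)

  +-assoc : ∀ a b c → (a + b) + c ≡ a + (b + c)
  +-assoc = toWitness {a? = all₃ λ a b c → (a + b) + c Fin.≟ a + (b + c)} _

  +-comm : ∀ a b → a + b ≡ b + a
  +-comm = toWitness {a? = all₂ λ a b → a + b Fin.≟ b + a} _

  +-identityˡ : ∀ a → 0# + a ≡ a
  +-identityˡ = toWitness {a? = all₁ λ a → 0# + a Fin.≟ a} _

  +-inverseˡ : ∀ a → (- a) + a ≡ 0#
  +-inverseˡ = toWitness {a? = all₁ λ a → (- a) + a Fin.≟ 0#} _

  *-assoc : ∀ a b c → (a * b) * c ≡ a * (b * c)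
  *-assoc = toWitness {a? = all₃ λ a b c → (a * b) * c Fin.≟ a * (b * c)} _

  *-comm : ∀ a b → a * b ≡ b * a
  *-comm = toWitness {a? = all₂ λ a b → a * b Fin.≟ b * a} _

  *-zeroʳ : ∀ a → a * 0# ≡ 0#
  *-zeroʳ = toWitness {a? = all₁ λ a → a * 0# Fin.≟ 0#} _

  distribˡ : ∀ a b c → a * (b + c) ≡ a * b + a * c
  distribˡ = toWitness {a? = all₃ λ a b c → a * (b + c) Fin.≟ a * b + a * c} _

-- The field with 3⁵ elements, as F₃[x]/(x⁵ + 2x + 1).
-- The vector (a₀, …, a₄) represents the class of a₀ + a₁x + … + a₄x⁴.

module F₃⁵ where

  infixl 6 _+_
  infixl 7 _*_ _·_

  F : Set
  F = Vec F₃.F 5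

  _+_ : F → F → F
  _+_ = zipWith F₃._+_

  -_ : F → F
  -_ = Vec.map F₃.-_

  0# 1# : F
  0# = replicate 5 F₃.0#
  1# = F₃.1# ∷ replicate 4 F₃.0#

  _·_ : F₃.F → F → F
  c · a = Vec.map (c F₃.*_) a

  -- multiplication by x, using x⁵ = x + 2
  x·_ : F → F
  x· (a₀ ∷ a₁ ∷ a₂ ∷ a₃ ∷ a₄ ∷ []) =
    (F₃.2# F₃.* a₄) ∷ (a₀ F₃.+ a₄) ∷ a₁ ∷ a₂ ∷ a₃ ∷ []

  -- Horner's rule: (a₀ + a₁x + …) b = a₀b + x (a₁b + x (…))
  horner : ∀ {n} → Vec F₃.F n → F → F
  horner []       b = 0#
  horner (a ∷ as) b = a · b + (x· horner as b)

  _*_ : F → F → F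
  _*_ = horner

  +-assoc : ∀ a b c → (a + b) + c ≡ a + (b + c)
  +-assoc = Vec.zipWith-assoc F₃.+-assoc

  +-comm : ∀ a b → a + b ≡ b + a
  +-comm = Vec.zipWith-comm F₃.+-comm

  +-identityˡ : ∀ a → 0# + a ≡ a
  +-identityˡ = Vec.zipWith-identityˡ F₃.+-identityˡ

  +-inverseˡ : ∀ a → (- a) + a ≡ 0#
  +-inverseˡ = Vec.zipWith-inverseˡ F₃.+-inverseˡ

  private
    +-interchange : ∀ a b c d → (a + b) + (c + d) ≡ (a + c) + (b + d)
    +-interchange a b c d = begin
      (a + b) + (c + d) ≡⟨ +-assoc a b (c + d) ⟩
      a + (b + (c + d)) ≡⟨ cong (a +_) (+-assoc b c d) ⟨
      a + ((b + c) + d) ≡⟨ cong (λ e → a + (e + d)) (+-comm b c) ⟩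
      a + ((c + b) + d) ≡⟨ cong (a +_) (+-assoc c b d) ⟩
      a + (c + (b + d)) ≡⟨ +-assoc a c (b + d) ⟨
      (a + c) + (b + d) ∎
      where open ≡-Reasoning

    ·-distribˡ : ∀ {n} c (a b : Vec F₃.F n) →
      Vec.map (c F₃.*_) (zipWith F₃._+_ a b) ≡
      zipWith F₃._+_ (Vec.map (c F₃.*_) a) (Vec.map (c F₃.*_) b)
    ·-distribˡ c []       []       = refl
    ·-distribˡ c (a ∷ as) (b ∷ bs) = cong₂ _∷_ (F₃.distribˡ c a b) (·-distribˡ c as bs)

    ·-comm : ∀ c d a → c · (d · a) ≡ d · (c · a)
    ·-comm c d a = begin
      c · (d · a)                   ≡⟨ Vec.map-∘ _ _ a ⟨
      Vec.map (λ e → c F₃.* (d F₃.* e)) a ≡⟨ Vec.map-cong swap a ⟩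
      Vec.map (λ e → d F₃.* (c F₃.* e)) a ≡⟨ Vec.map-∘ _ _ a ⟩
      d · (c · a)                   ∎
      where
      open ≡-Reasoning
      swap : ∀ e → c F₃.* (d F₃.* e) ≡ d F₃.* (c F₃.* e)
      swap e = trans (sym (F₃.*-assoc c d e))
        (trans (cong (F₃._* e) (F₃.*-comm c d)) (F₃.*-assoc d c e))

    ·-zero : ∀ c → c · 0# ≡ 0#
    ·-zero c = cong (replicate 5) (F₃.*-zeroʳ c)

    x-distrib : ∀ a b → (x· (a + b)) ≡ (x· a) + (x· b)
    x-distrib (a₀ ∷ a₁ ∷ a₂ ∷ a₃ ∷ a₄ ∷ []) (b₀ ∷ b₁ ∷ b₂ ∷ b₃ ∷ b₄ ∷ []) =
      cong₂ (λ p q → p ∷ q ∷ _) (F₃.distribˡ F₃.2# a₄ b₄) (swap a₀ b₀ a₄ b₄)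
      where
      swap : ∀ a b c d → (a F₃.+ b) F₃.+ (c F₃.+ d) ≡ (a F₃.+ c) F₃.+ (b F₃.+ d)
      swap a b c d = begin
        (a F₃.+ b) F₃.+ (c F₃.+ d) ≡⟨ F₃.+-assoc a b (c F₃.+ d) ⟩
        a F₃.+ (b F₃.+ (c F₃.+ d)) ≡⟨ cong (a F₃.+_) (F₃.+-assoc b c d) ⟨
        a F₃.+ ((b F₃.+ c) F₃.+ d) ≡⟨ cong (λ e → a F₃.+ (e F₃.+ d)) (F₃.+-comm b c) ⟩
        a F₃.+ ((c F₃.+ b) F₃.+ d) ≡⟨ cong (a F₃.+_) (F₃.+-assoc c b d) ⟩
        a F₃.+ (c F₃.+ (b F₃.+ d)) ≡⟨ F₃.+-assoc a c (b F₃.+ d) ⟨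
        (a F₃.+ c) F₃.+ (b F₃.+ d) ∎
        where open ≡-Reasoning

    x-· : ∀ c a → (x· (c · a)) ≡ c · (x· a)
    x-· c (a₀ ∷ a₁ ∷ a₂ ∷ a₃ ∷ a₄ ∷ []) =
      cong₂ (λ p q → p ∷ q ∷ _) swap (sym (F₃.distribˡ c a₀ a₄))
      where
      swap : F₃.2# F₃.* (c F₃.* a₄) ≡ c F₃.* (F₃.2# F₃.* a₄)
      swap = trans (sym (F₃.*-assoc F₃.2# c a₄))
        (trans (cong (F₃._* a₄) (F₃.*-comm F₃.2# c)) (F₃.*-assoc c F₃.2# a₄))

    horner-+ : ∀ {n} (as : Vec F₃.F n) b c → horner as (b + c) ≡ horner as b + horner as c
    horner-+ []       b c = refl
    horner-+ (a ∷ as) b c = begin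
      a · (b + c) + (x· horner as (b + c))
        ≡⟨ cong₂ _+_ (·-distribˡ a b c) (trans (cong x·_ (horner-+ as b c)) (x-distrib _ _)) ⟩
      (a · b + a · c) + ((x· horner as b) + (x· horner as c))
        ≡⟨ +-interchange (a · b) (a · c) _ _ ⟩
      (a · b + (x· horner as b)) + (a · c + (x· horner as c)) ∎
      where open ≡-Reasoning

    horner-· : ∀ {n} (as : Vec F₃.F n) c b → horner as (c · b) ≡ c · horner as b
    horner-· []       c b = sym (·-zero c)
    horner-· (a ∷ as) c b = begin
      a · (c · b) + (x· horner as (c · b))
        ≡⟨ cong₂ _+_ (·-comm a c b) (trans (cong x·_ (horner-· as c b)) (x-· c _)) ⟩
      c · (a · b) + c · (x· horner as b)
        ≡⟨ ·-distribˡ c (a · b) (x· horner as b) ⟨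
      c · (a · b + (x· horner as b)) ∎
      where open ≡-Reasoning

    horner-x : ∀ {n} (as : Vec F₃.F n) b → horner as (x· b) ≡ (x· horner as b)
    horner-x []       b = refl
    horner-x (a ∷ as) b = begin
      a · (x· b) + (x· horner as (x· b))
        ≡⟨ cong₂ _+_ (sym (x-· a b)) (cong x·_ (horner-x as b)) ⟩
      (x· (a · b)) + (x· (x· horner as b))
        ≡⟨ x-distrib (a · b) (x· horner as b) ⟨
      (x· (a · b + (x· horner as b))) ∎
      where open ≡-Reasoning

    horner-0 : ∀ {n} (as : Vec F₃.F n) → horner as 0# ≡ 0#
    horner-0 []       = refl
    horner-0 (a ∷ as) = cong₂ _+_ (·-zero a) (cong x·_ (horner-0 as))

    horner-comm : ∀ {n} a (bs : Vec F₃.F n) c → a * horner bs c ≡ horner bs (a * c)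
    horner-comm a []       c = horner-0 a
    horner-comm a (b ∷ bs) c = begin
      a * (b · c + (x· horner bs c))
        ≡⟨ horner-+ a (b · c) (x· horner bs c) ⟩
      a * (b · c) + a * (x· horner bs c)
        ≡⟨ cong₂ _+_ (horner-· a b c) (trans (horner-x a _) (cong x·_ (horner-comm a bs c))) ⟩
      b · (a * c) + (x· horner bs (a * c)) ∎
      where open ≡-Reasoning

    all? : ∀ {n} {P : Vec F₃.F n → Set} → Decidable P → Dec (∀ a → P a)
    all? {ℕ.zero}  P? = map′ (λ { p [] → p }) (λ f → f []) (P? [])
    all? {ℕ.suc n} P? =
      map′ (λ { f (a ∷ as) → f a as }) (λ f a as → f (a ∷ as))
           (Fin.all? λ a → all? λ as → P? (a ∷ as))

  infix 4 _≟_

  _≟_ : (a b : F) → Dec (a ≡ b)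
  _≟_ = Vec.≡-dec Fin._≟_

  *-identityʳ : ∀ a → a * 1# ≡ a
  *-identityʳ = toWitness {a? = all? λ a → a * 1# ≟ a} _

  *-comm : ∀ a b → a * b ≡ b * a
  *-comm a b = begin
    a * b        ≡⟨ cong (a *_) (*-identityʳ b) ⟨
    a * (b * 1#) ≡⟨ horner-comm a b 1# ⟩
    b * (a * 1#) ≡⟨ cong (b *_) (*-identityʳ a) ⟩
    b * a        ∎
    where open ≡-Reasoning

  *-assoc : ∀ a b c → (a * b) * c ≡ a * (b * c)
  *-assoc a b c = begin
    (a * b) * c ≡⟨ *-comm (a * b) c ⟩
    c * (a * b) ≡⟨ horner-comm c a b ⟩
    a * (c * b) ≡⟨ cong (a *_) (*-comm c b) ⟩
    a * (b * c) ∎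
    where open ≡-Reasoning

  distribˡ : ∀ a b c → a * (b + c) ≡ a * b + a * c
  distribˡ = horner-+

  distribʳ : ∀ a b c → (b + c) * a ≡ b * a + c * a
  distribʳ a b c = begin
    (b + c) * a   ≡⟨ *-comm (b + c) a ⟩
    a * (b + c)   ≡⟨ distribˡ a b c ⟩
    a * b + a * c ≡⟨ cong₂ _+_ (*-comm a b) (*-comm a c) ⟩
    b * a + c * a ∎
    where open ≡-Reasoning

  -- a²⁴¹; note 241 = 3⁵ − 2 = 1 + 2 (3 + 3² + 3³ + 3⁴)
  infix 8 _⁻¹
  _⁻¹ : F → F
  a ⁻¹ = a * square (cube (a * cube (a * cube (a * cube a))))
    where
    square cube : F → F
    square b = b * b
    cube b = b * square b

  private
    ZeroOrUnit : F → Set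
    ZeroOrUnit a = a ≡ 0# ⊎ a * a ⁻¹ ≡ 1#

    zeroOrUnit? : Decidable ZeroOrUnit
    zeroOrUnit? a = (a ≟ 0#) ⊎-dec (a * a ⁻¹ ≟ 1#)

    allZeroOrUnit? : Dec (∀ a → ZeroOrUnit a)
    allZeroOrUnit? = all? zeroOrUnit?

    zeroOrUnit : ∀ a → ZeroOrUnit a
    zeroOrUnit = toWitness {a? = allZeroOrUnit?} _

  *-inverseʳ : ∀ a → ¬ (a ≡ 0#) → a * a ⁻¹ ≡ 1#
  *-inverseʳ a a≢0 = fromInj₂ (λ a≡0 → contradiction a≡0 a≢0) (zeroOrUnit a)

  order : F ↔ Fin 243
  order = vectors 5
    where
    vectors : ∀ n → Vec F₃.F n ↔ Fin (3 ℕ.^ n)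
    vectors ℕ.zero = mk↔ₛ′ (λ _ → zero) (λ _ → []) (λ { zero → refl ; (suc ()) }) (λ { [] → refl })
    vectors (ℕ.suc n) =
      Compose.inverse
        (mk↔ₛ′ (λ { (a ∷ as) → a , as }) (λ { (a , as) → a ∷ as })
               (λ _ → refl) (λ { (_ ∷ _) → refl }))
        (Compose.inverse (Identity.↔-id F₃.F ×-↔ vectors n) (Symmetry.↔-sym Fin.*↔×))

  field₃⁵ : HeytingField 0ℓ 0ℓ 0ℓ
  field₃⁵ = record
    { Carrier = F
    ; _≈_ = _≡_
    ; _#_ = _≢_
    ; _+_ = _+_
    ; _*_ = _*_
    ; -_ = -_
    ; 0# = 0#
    ; 1# = 1#
    ; isHeytingField = record
      { isHeytingCommutativeRing = record
        { isCommutativeRing = record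
          { isRing = record
            { +-isAbelianGroup = record
              { isGroup = record
                { isMonoid = record
                  { isSemigroup = record
                    { isMagma = record { isEquivalence = isEquivalence ; ∙-cong = cong₂ _+_ }
                    ; assoc = +-assoc
                    }
                  ; identity = +-identityˡ , λ a → trans (+-comm a 0#) (+-identityˡ a)
                  }
                ; inverse = +-inverseˡ , +-inverseʳ
                ; ⁻¹-cong = cong -_
                }
              ; comm = +-comm
              }
            ; *-cong = cong₂ _*_
            ; *-assoc = *-assoc
            ; *-identity = (λ a → trans (*-comm 1# a) (*-identityʳ a)) , *-identityʳ
            ; distrib = distribˡ , distribʳ
            }
          ; *-comm = *-comm
          }
        ; isApartnessRelation = ≉-isApartnessRelation
        ; #⇒invertible = λ {a} {b} a≢b →
            let d≢0 = a≢b ∘ difference a b in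
            let d = a + (- b) in
            d ⁻¹ , trans (*-comm (d ⁻¹) d) (*-inverseʳ d d≢0) , *-inverseʳ d d≢0
        ; invertible⇒# = λ { {a} (e , e*d≡1 , _) refl →
            0≢1 (trans (sym (horner-0 e)) (trans (cong (e *_) (sym (+-inverseʳ a))) e*d≡1)) }
        }
      ; tight = ≉-tight
      }
    }
    where
    open import Relation.Binary.Properties.DecSetoid (≡.decSetoid _≟_)
      using (≉-isApartnessRelation; ≉-tight)

    +-inverseʳ : ∀ a → a + (- a) ≡ 0#
    +-inverseʳ a = trans (+-comm a (- a)) (+-inverseˡ a)

    0≢1 : ¬ (0# ≡ 1#)
    0≢1 ()

    difference : ∀ a b → a + (- b) ≡ 0# → a ≡ b
    difference a b eq = begin
      a               ≡⟨ trans (+-comm a 0#) (+-identityˡ a) ⟨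
      a + 0#          ≡⟨ cong (a +_) (+-inverseˡ b) ⟨
      a + ((- b) + b) ≡⟨ +-assoc a (- b) b ⟨
      (a + (- b)) + b ≡⟨ cong (_+ b) eq ⟩
      0# + b          ≡⟨ +-identityˡ b ⟩
      b               ∎
      where open ≡-Reasoning

  additiveGroup : AbelianGroup 0ℓ 0ℓ
  additiveGroup = CommutativeRing.+-abelianGroup
    (HeytingCommutativeRing.commutativeRing (HeytingField.heytingCommutativeRing field₃⁵))

{-# OPTIONS --safe #-}

-- Let μ₁₁ be the group of 11th roots of unity and let T contain one element of each
-- pair {t, −t} of 22nd roots of unity. Then V = {a | a¹¹ ∈ T} is a half-set, a union of
-- 11 cosets of μ₁₁, and these zero-sum cosets form one parallel class. Any zero-sum
-- transversal B of the cosets gives another class, the translates zB with z ∈ μ₁₁.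
-- Taking T and every B invariant under the Frobenius map, B = {1} ∪ {u^(3^k)} ∪ {w^(3^k)},
-- reduces the zero-sum condition to Tr u + Tr w = −1 and makes the search for eight
-- compatible transversals a clique problem on few vertices; the result is verified by
-- evaluation.
module Submission where

open import Defs

open import Algebra.Apartness.Bundles using (HeytingCommutativeRing; HeytingField)
open import Algebra.Bundles using (CommutativeRing)
open import Data.Fin.Base using (Fin; zero; suc)
import Data.Fin.Properties as Fin
open import Data.List.Base as List using (List; []; _∷_; _++_; filter; foldr; iterate; length; lookup; map)
import Data.List.Properties as List
import Data.List.Membership.DecPropositional as DecMembership
open import Data.List.Membership.Propositional using (_∈_)
open import Data.List.Membership.Propositional.Properties using (∈-AllPairs₂; ∈-filter⁺; ∈-lookup)
open import Data.List.Relation.Binary.Disjoint.Propositional using (Disjoint)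
import Data.List.Relation.Binary.Disjoint.DecPropositional as DecDisjoint
open import Data.List.Relation.Binary.Subset.Propositional using (_⊆_)
open import Data.List.Relation.Unary.All as All using (All; []; _∷_)
open import Data.List.Relation.Unary.All.Properties using (All-swap)
open import Data.List.Relation.Unary.AllPairs as AllPairs using (AllPairs; []; _∷_)
open import Data.List.Relation.Unary.Any as Any using (Any; here; there)
open import Data.List.Relation.Unary.Unique.Propositional using (Unique)
import Data.List.Relation.Unary.Unique.DecPropositional as DecUnique
open import Data.Nat.Base as ℕ using (ℕ; _≤_; s≤s)
import Data.Nat.Properties as ℕ
open import Data.Product.Base using (_×_; _,_; ∃)
open import Data.Sum.Base using (_⊎_; inj₁; inj₂)
open import Data.Vec.Base using ([]; _∷_)
open import Function.Base using (_∘_; id)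
open import Function.Bundles using (Inverse)
open import Relation.Binary.Core using (Rel)
open import Relation.Binary.Definitions using (Symmetric)
open import Relation.Binary.PropositionalEquality
open import Relation.Nullary using (¬_; Dec; contradiction; yes; no)
open import Relation.Nullary.Decidable using (map′; toWitness; _×-dec_; _⊎-dec_; _→-dec_; ¬?)
open import Relation.Unary using (Decidable)

open F₃⁵ using (F; _+_; -_; _*_; 0#; 1#; _≟_; field₃⁵; additiveGroup; order)
open DecMembership _≟_ using (_∈?_)
open DecDisjoint _≟_ using (disjoint?)
open DecUnique _≟_ using (unique?)
open CommutativeRing (HeytingCommutativeRing.commutativeRing (HeytingField.heytingCommutativeRing field₃⁵))
  using (semiring)
open import Algebra.Properties.Semiring.Exp semiring using (_^_)

-- `AllPairs` relates an entry only to later ones; symmetry supplies the opposite order.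
lookup-AllPairs : ∀ {a ℓ} {A : Set a} {R : Rel A ℓ} → Symmetric R → ∀ {xs} → AllPairs R xs →
                  ∀ {i j} → i ≢ j → R (lookup xs i) (lookup xs j)
lookup-AllPairs R-sym (_   ∷ _)   {zero}  {zero}  i≢j = contradiction refl i≢j
lookup-AllPairs R-sym (Rx  ∷ _)   {zero}  {suc j} _   = All.lookup Rx (∈-lookup j)
lookup-AllPairs R-sym (Rx  ∷ _)   {suc i} {zero}  _   = R-sym (All.lookup Rx (∈-lookup i))
lookup-AllPairs R-sym (_   ∷ Rxs) {suc i} {suc j} i≢j =
  lookup-AllPairs R-sym Rxs (i≢j ∘ cong suc)

∈-length≤1 : ∀ {a} {A : Set a} {xs : List A} → length xs ≤ 1 →
             ∀ {x y} → x ∈ xs → y ∈ xs → x ≡ y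
∈-length≤1 {xs = _ ∷ []}    _        (here refl) (here refl) = refl
∈-length≤1 {xs = _ ∷ _ ∷ _} (s≤s ())

MeetOnce : Rel (List F) _
MeetOnce B C = ∀ a b → a ∈ B → a ∈ C → b ∈ B → b ∈ C → a ≡ b

MeetOnce-sym : Symmetric MeetOnce
MeetOnce-sym meet a b a∈C a∈B b∈C b∈B = meet a b a∈B a∈C b∈B b∈C

AllMeetOnce : Rel (List (List F)) _
AllMeetOnce P Q = All (λ B → All (MeetOnce B) Q) P

AllMeetOnce-sym : Symmetric AllMeetOnce
AllMeetOnce-sym = All.map (All.map MeetOnce-sym) ∘ All-swap

-- A count of common points can be evaluated, whereas `MeetOnce` quantifies over all points.
meetOnce : ∀ B C → length (filter (_∈? C) B) ≤ 1 → MeetOnce B C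
meetOnce B C ≤1 a b a∈B a∈C b∈B b∈C =
  ∈-length≤1 ≤1 (∈-filter⁺ (_∈? C) a∈B a∈C) (∈-filter⁺ (_∈? C) b∈B b∈C)

sharedPoint⇒≡ : ∀ {P} → AllPairs Disjoint P → ∀ {B C : List F} → B ∈ P → C ∈ P →
                ∀ {a} → a ∈ B → a ∈ C → B ≡ C
sharedPoint⇒≡ disjoint B∈ C∈ a∈B a∈C with ∈-AllPairs₂ disjoint B∈ C∈
... | inj₁ B≡C        = B≡C
... | inj₂ (inj₁ B#C) = contradiction (a∈B , a∈C) B#C
... | inj₂ (inj₂ C#B) = contradiction (a∈C , a∈B) C#B

¬meetOnce-⊆ : ∀ {B C} → Unique B → 2 ≤ length B → B ⊆ C → ¬ MeetOnce B C
¬meetOnce-⊆ {_ ∷ []}    _                 (s≤s ())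
¬meetOnce-⊆ {_ ∷ _ ∷ _} ((a≢b ∷ _) ∷ _) _ B⊆C meet =
  a≢b (meet _ _ (here refl) (B⊆C (here refl)) (there (here refl)) (B⊆C (there (here refl))))

-- Two blocks through two distinct points cannot come from different classes, by `AllMeetOnce`, and
-- within one class they coincide by disjointness. Two classes cannot share a block either: it would
-- meet itself in `k` points, and `k` is at least 2.
heffterNet : ∀ {k V Ps} → 2 ≤ k → IsHalfSet additiveGroup (k ℕ.* k) V →
             (∀ {P} → P ∈ Ps → IsHeffterSystem additiveGroup (k ℕ.* k) k V P) →
             AllPairs AllMeetOnce Ps →
             HeffterNet additiveGroup (k ℕ.* k) k (length Ps)
heffterNet {k} {V} {Ps} 2≤k V-isHalfSet systems meets = record
  { v≡k²  = refl
  ; V     = V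
  ; class = lookup Ps
  ; isHalfSet = V-isHalfSet
  ; isPartialLinearSpace = record
    { within    = λ { (i , B∈) → All.lookup (System.Partition.within i) B∈ }
    ; atMostOne = atMostOne
    }
  ; isHeffterSystem = system
  ; classesDisjoint = classesDisjoint
  }
  where
  system : ∀ i → IsHeffterSystem additiveGroup _ _ V (lookup Ps i)
  system i = systems (∈-lookup i)

  module System (i : Fin (length Ps)) where
    open IsHeffterSystem (system i) public
    module Partition = IsPartition isPartition

  meetOnce-≢ : ∀ {i j} → i ≢ j → ∀ {B C} → B ∈ lookup Ps i → C ∈ lookup Ps j → MeetOnce B C
  meetOnce-≢ i≢j B∈ C∈ = All.lookup (All.lookup (lookup-AllPairs AllMeetOnce-sym meets i≢j) B∈) C∈

  atMostOne : ∀ {a b B C} → a ≢ b → (∃ λ i → B ∈ lookup Ps i) → (∃ λ i → C ∈ lookup Ps i) →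
              a ∈ B → b ∈ B → a ∈ C → b ∈ C → B ⊆ C × C ⊆ B
  atMostOne a≢b (i , B∈) (j , C∈) a∈B b∈B a∈C b∈C with i Fin.≟ j
  ... | no i≢j = contradiction (meetOnce-≢ i≢j B∈ C∈ _ _ a∈B a∈C b∈B b∈C) a≢b
  ... | yes refl with refl ← sharedPoint⇒≡ (System.Partition.disjoint i) B∈ C∈ a∈B a∈C = id , id

  classesDisjoint : ∀ {i j B C} → B ∈ lookup Ps i → C ∈ lookup Ps j → B ⊆ C × C ⊆ B → i ≡ j
  classesDisjoint {i} {j} B∈ C∈ (B⊆C , _) with i Fin.≟ j
  ... | yes i≡j = i≡j
  ... | no  i≢j = contradiction (meetOnce-≢ i≢j B∈ C∈)
    (¬meetOnce-⊆ (All.lookup (System.unique i) B∈) 2≤∣B∣ B⊆C)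
    where 2≤∣B∣ = subst (2 ≤_) (sym (All.lookup (System.size i) B∈)) 2≤k

isHalfSet : ∀ {V : F → Set} → ¬ V 0# → (∀ a → a ≢ 0# → (V a × ¬ V (- a)) ⊎ (¬ V a × V (- a))) →
            IsHalfSet additiveGroup 121 V
isHalfSet 0∉V exactlyOne = record
  { order      = order
  -- 243 = 7 + 236.
  ; order≥7    = ℕ.m≤m+n 7 236
  ; respects   = λ { refl Va → Va }
  ; 0∉V        = 0∉V
  ; exactlyOne = exactlyOne
  }

all? : {P : F → Set} → Decidable P → Dec (∀ x → P x)
all? {P} P? = map′ (λ p x → subst P (order.strictlyInverseʳ x) (p (order.to x))) (_∘ order.from)
                   (Fin.all? (P? ∘ order.from))
  where module order = Inverse order

-- The norm of `x` gives x^121 = -1, and x^22 is not 1, so `x` generates the multiplicative group,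
-- of order 242, and `ζ` is a primitive 11th root of unity.
x ζ : F
x = F₃.0# ∷ F₃.1# ∷ F₃.0# ∷ F₃.0# ∷ F₃.0# ∷ []
ζ = x ^ 22

-- Five entries suffice because a^(3^5) = a.
frobeniusOrbit : F → List F
frobeniusOrbit a = iterate (_^ 3) a 5

base : F → F → List F
base a b = 1# ∷ frobeniusOrbit a ++ frobeniusOrbit b

μ₁₁ : List F
μ₁₁ = iterate (ζ *_) 1# 11

-- The set T is a parameter of the decision procedures so that it is evaluated only once.
HalfSet : List F → F → Set
HalfSet T a = a ^ 11 ∈ T

halfSet? : ∀ T → Decidable (HalfSet T)
halfSet? T a = a ^ 11 ∈? T

-- As powers of x^11, the elements of T have exponents 0, 7·3^k and 4·3^k modulo 22. These are
-- distinct modulo 11, and -1 is the 11th power of x^11, so T picks one element of each pair {t,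
-- -t}.
V : F → Set
V = HalfSet (base (x ^ 77) (x ^ 44))

-- Multiplication by an element of `μ₁₁` preserves 11th powers, so each translate of a transversal
-- is again one, with sum still zero.
transversalClass : ℕ × ℕ → List (List F)
transversalClass (m , n) = map (λ z → map (z *_) (base (x ^ m) (x ^ n))) μ₁₁

-- The representatives have T as their set of 11th powers: x^7 goes to x^77, and x^14 to x^154, a
-- Frobenius conjugate of x^44.
cosetClass : List (List F)
cosetClass = map (λ a → map (a *_) μ₁₁) (base (x ^ 7) (x ^ 14))

-- A computer search over pairs of Frobenius orbits gave the exponents.
classes : List (List (List F))
classes = cosetClass ∷ map transversalClass
  ((41 , 152) ∷ (43 , 70) ∷ (17 , 80) ∷ (7 , 14) ∷ (131 , 16) ∷ (13 , 38) ∷ (19 , 20) ∷ (79 , 34) ∷ [])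

exactlyOne? : ∀ T → Dec (∀ a → a ≢ 0# → (HalfSet T a × ¬ HalfSet T (- a)) ⊎ (¬ HalfSet T a × HalfSet T (- a)))
exactlyOne? T = all? λ a → ¬? (a ≟ 0#) →-dec
  ((halfSet? T a ×-dec ¬? (halfSet? T (- a))) ⊎-dec (¬? (halfSet? T a) ×-dec halfSet? T (- a)))

V-exactlyOne : ∀ a → a ≢ 0# → (V a × ¬ V (- a)) ⊎ (¬ V a × V (- a))
V-exactlyOne = toWitness {a? = exactlyOne? _} _

classes-nonempty : All (All (λ B → ¬ (B ≡ []))) classes
classes-nonempty = toWitness {a? = All.all? (All.all? λ B → ¬? (List.≡-dec _≟_ B [])) classes} _

within? : ∀ T Ps → Dec (All (All (All (HalfSet T))) Ps)
within? T = All.all? (All.all? (All.all? (halfSet? T)))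

classes-within : All (All (All V)) classes
classes-within = toWitness {a? = within? _ classes} _

cover? : ∀ T Ps → Dec (∀ a → HalfSet T a → All (Any (a ∈_)) Ps)
cover? T Ps = all? λ a → halfSet? T a →-dec All.all? (Any.any? (a ∈?_)) Ps

classes-cover : ∀ a → V a → All (Any (a ∈_)) classes
classes-cover = toWitness {a? = cover? _ classes} _

classes-disjoint : All (AllPairs Disjoint) classes
classes-disjoint = toWitness {a? = All.all? (AllPairs.allPairs? disjoint?) classes} _

classes-unique : All (All Unique) classes
classes-unique = toWitness {a? = All.all? (All.all? unique?) classes} _

classes-size : All (All (λ B → length B ≡ 11)) classes
classes-size = toWitness {a? = All.all? (All.all? λ B → length B ℕ.≟ 11) classes} _

classes-zeroSum : All (All (λ B → foldr _+_ 0# B ≡ 0#)) classes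
classes-zeroSum = toWitness {a? = All.all? (All.all? λ B → foldr _+_ 0# B ≟ 0#) classes} _

classes-meetOnce : AllPairs AllMeetOnce classes
-- Only the numbers of common points are evaluated; `meetOnce` converts the bounds.
classes-meetOnce = AllPairs.map (All.map λ {B} → All.map λ {C} → meetOnce B C)
  (toWitness {a? = AllPairs.allPairs?
    (λ P Q → All.all? (λ B → All.all? (λ C → length (filter (_∈? C) B) ℕ.≤? 1) Q) P) classes} _)

V-isHalfSet : IsHalfSet additiveGroup 121 V
V-isHalfSet = isHalfSet (toWitness {a? = ¬? (halfSet? _ 0#)} _) V-exactlyOne

classes-isHeffterSystem : ∀ {P} → P ∈ classes → IsHeffterSystem additiveGroup 121 11 V P
classes-isHeffterSystem P∈ = record
  { isHalfSet   = V-isHalfSet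
  ; isPartition = record
    { nonempty = All.lookup classes-nonempty P∈
    ; within   = All.lookup classes-within P∈
    ; covers   = λ a Va → All.lookup (classes-cover a Va) P∈
    ; disjoint = All.lookup classes-disjoint P∈
    }
  ; unique  = All.lookup classes-unique P∈
  ; size    = All.lookup classes-size P∈
  ; zeroSum = All.lookup classes-zeroSum P∈
  }

theorem5p3 : HeffterNet F₃⁵.additiveGroup 121 11 9
theorem5p3 = heffterNet (ℕ.m≤m+n 2 9) V-isHalfSet classes-isHeffterSystem classes-meetOnce
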